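{- (1) For all VFS-terms $M$ and VFS-values $V$: $(M^{ - })^{+}=M$, $(M^{\wr})^{\times}=M$ and $(V^{\sim})^{\times\times}=V$. (2) For all CPS-terms $P$, CPS-commands $M$ and CPS-values $V$: $(P^{+})^{ - }=P$, $(M^{\times})^{\wr}=M$ and $(V^{\times\times})^{\sim}=V$. (3) For all VFS-terms $M_1,M_2$, if $M_1\to M_2$ in VFS then $M_1^{\wr}\to M_2^{\wr}$ in CPS (hence $M_1^{ - }\to M_2^{ - }$ in CPS). (4) For all CPS-commands $M_1,M_2$, if $M_1\to M_2$ in CPS then $M_1^{\times}\to M_2^{\times}$ in VFS; hence for all CPS-terms $P_1,P_2$, if $P_1\to P_2$ in CPS then $P_1^{+}\to P_2^{+}$ in VFS.
   Context: Terms are identified up to $\alpha$-equivalence; substitution is capture-avoiding; one-step reduction $\to$ in each calculus is the closure of its rules under all syntactic constructors. The calculus VFS: terms $M,N::=\uparrow V\mid \mathsf{C}_v(V,c)$; values $V,W::=x\mid\lambda x.M$; formal contexts $c::= x.M\mid (W,x.M)$ ($x$ bound in $M$). Auxiliary: $(\uparrow V:c')=\mathsf{C}_v(V,c')$; $(\mathsf{C}_v(V,c):c')=\mathsf{C}_v(V,(c:c'))$; $((x.M):c')=x.(M:c')$; $((W,x.M):c')=(W,x.(M:c'))$. Rules: $(B_v)$ $\mathsf{C}_v(\lambda x.M,(V,y.N))\to\mathsf{C}_v(V,x.(M:y.N))$; $(\sigma_v)$ $\mathsf{C}_v(V,y.N)\to[V/y]N$. The calculus CPS: a fixed variable $k$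 (covariable). Commands $M,N::=kV\mid KV\mid VWK$; continuations $K::=\lambda x.M$; values $V,W::=\lambda x.P\mid x$; terms $P::=\lambda k.M$. Rules: $(\sigma_v)$ $(\lambda x.M)V\to[V/x]M$; $(B_v)$ $(\lambda x.\lambda k.M)WK\to(\lambda x.[K/k]M)W$. Negative translation VFS$\to$CPS: $x^{\sim}=x$; $(\lambda x.M)^{\sim}=\lambda x.M^{ - }$; $M^{ - }=\lambda k.M^{\wr}$; $(\uparrow V)^{\wr}=kV^{\sim}$; $(\mathsf{C}_v(V,x.M))^{\wr}=(\lambda x.M^{\wr})V^{\sim}$; $(\mathsf{C}_v(V,(W,x.M)))^{\wr}=V^{\sim}W^{\sim}(\lambda x.M^{\wr})$. Inverse translation CPS$\to$VFS: $(\lambda k.M)^{+}=M^{\times}$; $(kV)^{\times}=\uparrow(V^{\times\times})$; $((\lambda x.M)V)^{\times}=\mathsf{C}_v(V^{\times\times},x.M^{\times})$; $(VW(\lambda x.M))^{\times}=\mathsf{C}_v(V^{\times\times},(W^{\times\times},x.M^{\times}))$; $x^{\times\times}=x$; $(\lambda x.P)^{\times\times}=\lambda x.P^{+}$. -}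

module Defs where

-- Scoped de Bruijn syntax: terms are identified up to alpha-equivalence.
-- The index n counts the free (ordinary) variables in scope.
-- In CPS the covariable k is a single fixed name: every occurrence of k
-- refers to the nearest enclosing binder "λk" (or is free).

open import Data.Nat using (ℕ; zero; suc)
open import Data.Fin using (Fin; zero; suc)

mutual
  data VTm (n : ℕ) : Set where
    ↑_ : VVal n → VTm n
    Cv : VVal n → VCx n → VTm n

  data VVal (n : ℕ) : Set where
    vvar : Fin n → VVal n
    vlam : VTm (suc n) → VVal n

  data VCx (n : ℕ) : Set where
    cabs : VTm (suc n) → VCx n
    cpair : VVal n → VTm (suc n) → VCx n

extr : ∀ {n m} → (Fin n → Fin m) → Fin (suc n) → Fin (suc m)
extr ρ zero = zero
extr ρ (suc i) = suc (ρ i)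

mutual
  renVT : ∀ {n m} → (Fin n → Fin m) → VTm n → VTm m
  renVT ρ (↑ V) = ↑ (renVV ρ V)
  renVT ρ (Cv V c) = Cv (renVV ρ V) (renVC ρ c)

  renVV : ∀ {n m} → (Fin n → Fin m) → VVal n → VVal m
  renVV ρ (vvar x) = vvar (ρ x)
  renVV ρ (vlam M) = vlam (renVT (extr ρ) M)

  renVC : ∀ {n m} → (Fin n → Fin m) → VCx n → VCx m
  renVC ρ (cabs M) = cabs (renVT (extr ρ) M)
  renVC ρ (cpair W M) = cpair (renVV ρ W) (renVT (extr ρ) M)

extsV : ∀ {n m} → (Fin n → VVal m) → Fin (suc n) → VVal (suc m)
extsV σ zero = vvar zero
extsV σ (suc i) = renVV suc (σ i)

mutual
  subVT : ∀ {n m} → (Fin n → VVal m) → VTm n → VTm m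
  subVT σ (↑ V) = ↑ (subVV σ V)
  subVT σ (Cv V c) = Cv (subVV σ V) (subVC σ c)

  subVV : ∀ {n m} → (Fin n → VVal m) → VVal n → VVal m
  subVV σ (vvar x) = σ x
  subVV σ (vlam M) = vlam (subVT (extsV σ) M)

  subVC : ∀ {n m} → (Fin n → VVal m) → VCx n → VCx m
  subVC σ (cabs M) = cabs (subVT (extsV σ) M)
  subVC σ (cpair W M) = cpair (subVV σ W) (subVT (extsV σ) M)

-- single substitution [V/x]M, x the outermost bound variable (index 0)
sub0V : ∀ {n} → VVal n → Fin (suc n) → VVal n
sub0V V zero = V
sub0V V (suc i) = vvar i

_[_]V : ∀ {n} → VTm (suc n) → VVal n → VTm n
M [ V ]V = subVT (sub0V V) M

mutual
  _∶ₜ_ : ∀ {n} → VTm n → VCx n → VTm n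
  (↑ V) ∶ₜ c' = Cv V c'
  (Cv V c) ∶ₜ c' = Cv V (c ∶ₓ c')

  _∶ₓ_ : ∀ {n} → VCx n → VCx n → VCx n
  (cabs M) ∶ₓ c' = cabs (M ∶ₜ renVC suc c')
  (cpair W M) ∶ₓ c' = cpair W (M ∶ₜ renVC suc c')

mutual
  data _⟶V_ {n : ℕ} : VTm n → VTm n → Set where
    Bv : ∀ {M : VTm (suc n)} {V : VVal n} {N : VTm (suc n)} →
         Cv (vlam M) (cpair V N) ⟶V Cv V (cabs (M ∶ₜ renVC suc (cabs N)))
    σv : ∀ {V : VVal n} {N : VTm (suc n)} →
         Cv V (cabs N) ⟶V (N [ V ]V)
    ξ↑ : ∀ {V V'} → V ⟶VV V' → (↑ V) ⟶V (↑ V')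
    ξCv₁ : ∀ {V V' c} → V ⟶VV V' → Cv V c ⟶V Cv V' c
    ξCv₂ : ∀ {V c c'} → c ⟶VC c' → Cv V c ⟶V Cv V c'

  data _⟶VV_ {n : ℕ} : VVal n → VVal n → Set where
    ξlam : ∀ {M M'} → M ⟶V M' → vlam M ⟶VV vlam M'

  data _⟶VC_ {n : ℕ} : VCx n → VCx n → Set where
    ξabs : ∀ {M M'} → M ⟶V M' → cabs M ⟶VC cabs M'
    ξpair₁ : ∀ {W W' M} → W ⟶VV W' → cpair W M ⟶VC cpair W' M
    ξpair₂ : ∀ {W M M'} → M ⟶V M' → cpair W M ⟶VC cpair W M'

mutual
  data Cmd (n : ℕ) : Set where
    kV : CVal n → Cmd n
    KV : Cont n → CVal n → Cmd n
    VWK : CVal n → CVal n → Cont n → Cmd n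

  data Cont (n : ℕ) : Set where
    λx : Cmd (suc n) → Cont n

  data CVal (n : ℕ) : Set where
    cvar : Fin n → CVal n
    cλ : CTm (suc n) → CVal n

  data CTm (n : ℕ) : Set where
    λk : Cmd n → CTm n

mutual
  renCM : ∀ {n m} → (Fin n → Fin m) → Cmd n → Cmd m
  renCM ρ (kV V) = kV (renCV ρ V)
  renCM ρ (KV K V) = KV (renCK ρ K) (renCV ρ V)
  renCM ρ (VWK V W K) = VWK (renCV ρ V) (renCV ρ W) (renCK ρ K)

  renCK : ∀ {n m} → (Fin n → Fin m) → Cont n → Cont m
  renCK ρ (λx M) = λx (renCM (extr ρ) M)

  renCV : ∀ {n m} → (Fin n → Fin m) → CVal n → CVal m
  renCV ρ (cvar x) = cvar (ρ x)
  renCV ρ (cλ P) = cλ (renCP (extr ρ) P)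

  renCP : ∀ {n m} → (Fin n → Fin m) → CTm n → CTm m
  renCP ρ (λk M) = λk (renCM ρ M)

extsC : ∀ {n m} → (Fin n → CVal m) → Fin (suc n) → CVal (suc m)
extsC σ zero = cvar zero
extsC σ (suc i) = renCV suc (σ i)

mutual
  subCM : ∀ {n m} → (Fin n → CVal m) → Cmd n → Cmd m
  subCM σ (kV V) = kV (subCV σ V)
  subCM σ (KV K V) = KV (subCK σ K) (subCV σ V)
  subCM σ (VWK V W K) = VWK (subCV σ V) (subCV σ W) (subCK σ K)

  subCK : ∀ {n m} → (Fin n → CVal m) → Cont n → Cont m
  subCK σ (λx M) = λx (subCM (extsC σ) M)

  subCV : ∀ {n m} → (Fin n → CVal m) → CVal n → CVal m
  subCV σ (cvar x) = σ x
  subCV σ (cλ P) = cλ (subCP (extsC σ) P)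

  subCP : ∀ {n m} → (Fin n → CVal m) → CTm n → CTm m
  subCP σ (λk M) = λk (subCM σ M)

sub0C : ∀ {n} → CVal n → Fin (suc n) → CVal n
sub0C V zero = V
sub0C V (suc i) = cvar i

_[_]C : ∀ {n} → Cmd (suc n) → CVal n → Cmd n
M [ V ]C = subCM (sub0C V) M

-- capture-avoiding substitution [K/k] of a continuation for the free
-- covariable k.  Values never contain free k (it is rebound by λk), so
-- the substitution stops at values.
mutual
  ksubM : ∀ {n} → Cont n → Cmd n → Cmd n
  ksubM K (kV V) = KV K V
  ksubM K (KV K' V) = KV (ksubK K K') V
  ksubM K (VWK V W K') = VWK V W (ksubK K K')

  ksubK : ∀ {n} → Cont n → Cont n → Cont n
  ksubK K (λx M) = λx (ksubM (renCK suc K) M)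

mutual
  data _⟶M_ {n : ℕ} : Cmd n → Cmd n → Set where
    σv : ∀ {M : Cmd (suc n)} {V : CVal n} →
         KV (λx M) V ⟶M (M [ V ]C)
    Bv : ∀ {M : Cmd (suc n)} {W : CVal n} {K : Cont n} →
         VWK (cλ (λk M)) W K ⟶M KV (λx (ksubM (renCK suc K) M)) W
    ξkV : ∀ {V V'} → V ⟶CV V' → kV V ⟶M kV V'
    ξKV₁ : ∀ {K K' V} → K ⟶K K' → KV K V ⟶M KV K' V
    ξKV₂ : ∀ {K V V'} → V ⟶CV V' → KV K V ⟶M KV K V'
    ξVWK₁ : ∀ {V V' W K} → V ⟶CV V' → VWK V W K ⟶M VWK V' W K
    ξVWK₂ : ∀ {V W W' K} → W ⟶CV W' → VWK V W K ⟶M VWK V W' K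
    ξVWK₃ : ∀ {V W K K'} → K ⟶K K' → VWK V W K ⟶M VWK V W K'

  data _⟶K_ {n : ℕ} : Cont n → Cont n → Set where
    ξλx : ∀ {M M'} → M ⟶M M' → λx M ⟶K λx M'

  data _⟶CV_ {n : ℕ} : CVal n → CVal n → Set where
    ξcλ : ∀ {P P'} → P ⟶P P' → cλ P ⟶CV cλ P'

  data _⟶P_ {n : ℕ} : CTm n → CTm n → Set where
    ξλk : ∀ {M M'} → M ⟶M M' → λk M ⟶P λk M'

mutual
  _∼ : ∀ {n} → VVal n → CVal n
  vvar x ∼ = cvar x
  vlam M ∼ = cλ (M ⁻)

  _⁻ : ∀ {n} → VTm n → CTm n
  M ⁻ = λk (M ≀)

  _≀ : ∀ {n} → VTm n → Cmd n
  (↑ V) ≀ = kV (V ∼)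
  Cv V (cabs M) ≀ = KV (λx (M ≀)) (V ∼)
  Cv V (cpair W M) ≀ = VWK (V ∼) (W ∼) (λx (M ≀))

mutual
  _⁺ : ∀ {n} → CTm n → VTm n
  λk M ⁺ = M ˣ

  _ˣ : ∀ {n} → Cmd n → VTm n
  kV V ˣ = ↑ (V ˣˣ)
  KV (λx M) V ˣ = Cv (V ˣˣ) (cabs (M ˣ))
  VWK V W (λx M) ˣ = Cv (V ˣˣ) (cpair (W ˣˣ) (M ˣ))

  _ˣˣ : ∀ {n} → CVal n → VVal n
  cvar x ˣˣ = vvar x
  cλ P ˣˣ = vlam (P ⁺)

module Submission where

-- The two translations are mutually inverse bijections which are literally
-- clause-by-clause renamings of constructors, so (1) and (2) are structural.
-- Reductions are preserved because the translation commutes with renaming and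
-- substitution, and because the colon operation M : (x.N) of VFS is the same
-- thing as the covariable substitution [λx.N/k] in CPS.  Part (4) then needs
-- no separate analysis: the equations for ˣ follow from those for ≀ by
-- applying the inverse.

open import Data.Nat using (suc)
open import Data.Fin using (Fin; zero; suc)
open import Data.Product using (_×_; _,_)
open import Relation.Binary.PropositionalEquality
open ≡-Reasoning

open import Defs

cong₃ : ∀ {A B C D : Set} (f : A → B → C → D) {a a′ b b′ c c′} →
        a ≡ a′ → b ≡ b′ → c ≡ c′ → f a b c ≡ f a′ b′ c′
cong₃ f refl refl refl = refl

mutual
  ˣ-≀ : ∀ {n} (M : VTm n) → (M ≀) ˣ ≡ M
  ˣ-≀ (↑ V)              = cong ↑_ (ˣˣ-∼ V)
  ˣ-≀ (Cv V (cabs M))    = cong₂ Cv (ˣˣ-∼ V) (cong cabs (ˣ-≀ M))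
  ˣ-≀ (Cv V (cpair W M)) =
    cong₃ (λ V′ W′ M′ → Cv V′ (cpair W′ M′)) (ˣˣ-∼ V) (ˣˣ-∼ W) (ˣ-≀ M)

  ˣˣ-∼ : ∀ {n} (V : VVal n) → (V ∼) ˣˣ ≡ V
  ˣˣ-∼ (vvar x) = refl
  ˣˣ-∼ (vlam M) = cong vlam (ˣ-≀ M)

⁺-⁻ : ∀ {n} (M : VTm n) → (M ⁻) ⁺ ≡ M
⁺-⁻ = ˣ-≀

mutual
  ≀-ˣ : ∀ {n} (M : Cmd n) → (M ˣ) ≀ ≡ M
  ≀-ˣ (kV V)             = cong kV (∼-ˣˣ V)
  ≀-ˣ (KV (λx M) V)      = cong₂ KV (cong λx (≀-ˣ M)) (∼-ˣˣ V)
  ≀-ˣ (VWK V W (λx M))   = cong₃ VWK (∼-ˣˣ V) (∼-ˣˣ W) (cong λx (≀-ˣ M))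

  ∼-ˣˣ : ∀ {n} (V : CVal n) → (V ˣˣ) ∼ ≡ V
  ∼-ˣˣ (cvar x)      = refl
  ∼-ˣˣ (cλ (λk M))   = cong (λ M′ → cλ (λk M′)) (≀-ˣ M)

⁻-⁺ : ∀ {n} (P : CTm n) → (P ⁺) ⁻ ≡ P
⁻-⁺ (λk M) = cong λk (≀-ˣ M)

ˣ-unique : ∀ {n} {M : Cmd n} {N : VTm n} → M ≡ N ≀ → M ˣ ≡ N
ˣ-unique {N = N} M≡N≀ = trans (cong _ˣ M≡N≀) (ˣ-≀ N)

mutual
  ≀-renVT : ∀ {n m} (ρ : Fin n → Fin m) (M : VTm n) → (renVT ρ M) ≀ ≡ renCM ρ (M ≀)
  ≀-renVT ρ (↑ V)              = cong kV (∼-renVV ρ V)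
  ≀-renVT ρ (Cv V (cabs M))    = cong₂ KV (cong λx (≀-renVT (extr ρ) M)) (∼-renVV ρ V)
  ≀-renVT ρ (Cv V (cpair W M)) =
    cong₃ VWK (∼-renVV ρ V) (∼-renVV ρ W) (cong λx (≀-renVT (extr ρ) M))

  ∼-renVV : ∀ {n m} (ρ : Fin n → Fin m) (V : VVal n) → (renVV ρ V) ∼ ≡ renCV ρ (V ∼)
  ∼-renVV ρ (vvar x) = refl
  ∼-renVV ρ (vlam M) = cong (λ M′ → cλ (λk M′)) (≀-renVT (extr ρ) M)

_∼≗_ : ∀ {n m} → (Fin n → VVal m) → (Fin n → CVal m) → Set
σ ∼≗ τ = ∀ i → (σ i) ∼ ≡ τ i

∼≗-exts : ∀ {n m} {σ : Fin n → VVal m} {τ : Fin n → CVal m} →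
          σ ∼≗ τ → extsV σ ∼≗ extsC τ
∼≗-exts σ∼≗τ zero              = refl
∼≗-exts {σ = σ} σ∼≗τ (suc i) = trans (∼-renVV suc (σ i)) (cong (renCV suc) (σ∼≗τ i))

mutual
  ≀-subVT : ∀ {n m} {σ : Fin n → VVal m} {τ : Fin n → CVal m} → σ ∼≗ τ →
            (M : VTm n) → (subVT σ M) ≀ ≡ subCM τ (M ≀)
  ≀-subVT σ∼≗τ (↑ V)              = cong kV (∼-subVV σ∼≗τ V)
  ≀-subVT σ∼≗τ (Cv V (cabs M))    =
    cong₂ KV (cong λx (≀-subVT (∼≗-exts σ∼≗τ) M)) (∼-subVV σ∼≗τ V)
  ≀-subVT σ∼≗τ (Cv V (cpair W M)) =
    cong₃ VWK (∼-subVV σ∼≗τ V) (∼-subVV σ∼≗τ W) (cong λx (≀-subVT (∼≗-exts σ∼≗τ) M))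

  ∼-subVV : ∀ {n m} {σ : Fin n → VVal m} {τ : Fin n → CVal m} → σ ∼≗ τ →
            (V : VVal n) → (subVV σ V) ∼ ≡ subCV τ (V ∼)
  ∼-subVV σ∼≗τ (vvar x) = σ∼≗τ x
  ∼-subVV σ∼≗τ (vlam M) = cong (λ M′ → cλ (λk M′)) (≀-subVT (∼≗-exts σ∼≗τ) M)

≀-[] : ∀ {n} (N : VTm (suc n)) (V : VVal n) → (N [ V ]V) ≀ ≡ (N ≀) [ V ∼ ]C
≀-[] N V = ≀-subVT sub0-∼≗ N
  where
  sub0-∼≗ : sub0V V ∼≗ sub0C (V ∼)
  sub0-∼≗ zero    = refl
  sub0-∼≗ (suc i) = refl

mutual
  ≀-∶ₜ : ∀ {n} (M N : VTm (suc n)) →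
         (M ∶ₜ renVC suc (cabs N)) ≀ ≡ ksubM (renCK suc (λx (N ≀))) (M ≀)
  ≀-∶ₜ (↑ V)              N = cong (λ N′ → KV (λx N′) (V ∼)) (≀-renVT (extr suc) N)
  ≀-∶ₜ (Cv V (cabs M))    N = cong (λ M′ → KV (λx M′) (V ∼)) (≀-∶ₜ-weakened M N)
  ≀-∶ₜ (Cv V (cpair W M)) N = cong (λ M′ → VWK (V ∼) (W ∼) (λx M′)) (≀-∶ₜ-weakened M N)

  -- Under the binder of M the context x.N must itself be weakened, which is
  -- the same as weakening its translation.
  ≀-∶ₜ-weakened : ∀ {n} (M : VTm (suc (suc n))) (N : VTm (suc n)) →
                  (M ∶ₜ renVC suc (cabs (renVT (extr suc) N))) ≀
                    ≡ ksubM (renCK suc (λx (renCM (extr suc) (N ≀)))) (M ≀)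
  ≀-∶ₜ-weakened M N = begin
    (M ∶ₜ renVC suc (cabs (renVT (extr suc) N))) ≀
      ≡⟨ ≀-∶ₜ M (renVT (extr suc) N) ⟩
    ksubM (renCK suc (λx ((renVT (extr suc) N) ≀))) (M ≀)
      ≡⟨ cong (λ N′ → ksubM (renCK suc (λx N′)) (M ≀)) (≀-renVT (extr suc) N) ⟩
    ksubM (renCK suc (λx (renCM (extr suc) (N ≀)))) (M ≀) ∎

ˣ-[] : ∀ {n} (M : Cmd (suc n)) (V : CVal n) → (M [ V ]C) ˣ ≡ (M ˣ) [ V ˣˣ ]V
ˣ-[] M V = ˣ-unique (begin
  M [ V ]C                    ≡⟨ sym (cong₂ _[_]C (≀-ˣ M) (∼-ˣˣ V)) ⟩
  ((M ˣ) ≀) [ (V ˣˣ) ∼ ]C     ≡⟨ sym (≀-[] (M ˣ) (V ˣˣ)) ⟩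
  ((M ˣ) [ V ˣˣ ]V) ≀         ∎)

ˣ-ksubM : ∀ {n} (M N : Cmd (suc n)) →
          (ksubM (renCK suc (λx N)) M) ˣ ≡ (M ˣ) ∶ₜ renVC suc (cabs (N ˣ))
ˣ-ksubM M N = ˣ-unique (begin
  ksubM (renCK suc (λx N)) M
    ≡⟨ sym (cong₂ (λ N′ M′ → ksubM (renCK suc (λx N′)) M′) (≀-ˣ N) (≀-ˣ M)) ⟩
  ksubM (renCK suc (λx ((N ˣ) ≀))) ((M ˣ) ≀)
    ≡⟨ sym (≀-∶ₜ (M ˣ) (N ˣ)) ⟩
  ((M ˣ) ∶ₜ renVC suc (cabs (N ˣ))) ≀ ∎)

⟶M-≡ʳ : ∀ {n} {M N N′ : Cmd n} → N ≡ N′ → M ⟶M N → M ⟶M N′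
⟶M-≡ʳ refl M⟶N = M⟶N

⟶V-≡ʳ : ∀ {n} {M N N′ : VTm n} → N ≡ N′ → M ⟶V N → M ⟶V N′
⟶V-≡ʳ refl M⟶N = M⟶N

mutual
  ≀-⟶ : ∀ {n} {M₁ M₂ : VTm n} → M₁ ⟶V M₂ → (M₁ ≀) ⟶M (M₂ ≀)
  ≀-⟶ (Bv {M = M} {V} {N})            =
    ⟶M-≡ʳ (cong (λ M′ → KV (λx M′) (V ∼)) (sym (≀-∶ₜ M N))) (Bv {K = λx (N ≀)})
  ≀-⟶ (σv {V = V} {N})                = ⟶M-≡ʳ (sym (≀-[] N V)) (σv {M = N ≀})
  ≀-⟶ (ξ↑ V⟶V′)                       = ξkV (∼-⟶ V⟶V′)
  ≀-⟶ (ξCv₁ {c = cabs M} V⟶V′)        = ξKV₂ (∼-⟶ V⟶V′)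
  ≀-⟶ (ξCv₁ {c = cpair W M} V⟶V′)     = ξVWK₁ (∼-⟶ V⟶V′)
  ≀-⟶ (ξCv₂ (ξabs M⟶M′))              = ξKV₁ (ξλx (≀-⟶ M⟶M′))
  ≀-⟶ (ξCv₂ (ξpair₁ W⟶W′))            = ξVWK₂ (∼-⟶ W⟶W′)
  ≀-⟶ (ξCv₂ (ξpair₂ M⟶M′))            = ξVWK₃ (ξλx (≀-⟶ M⟶M′))

  ∼-⟶ : ∀ {n} {V₁ V₂ : VVal n} → V₁ ⟶VV V₂ → (V₁ ∼) ⟶CV (V₂ ∼)
  ∼-⟶ (ξlam M⟶M′) = ξcλ (ξλk (≀-⟶ M⟶M′))

mutual
  ˣ-⟶ : ∀ {n} {M₁ M₂ : Cmd n} → M₁ ⟶M M₂ → (M₁ ˣ) ⟶V (M₂ ˣ)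
  ˣ-⟶ (σv {M = M} {V})                = ⟶V-≡ʳ (sym (ˣ-[] M V)) (σv {N = M ˣ})
  ˣ-⟶ (Bv {M = M} {W} {λx N})         =
    ⟶V-≡ʳ (cong (λ M′ → Cv (W ˣˣ) (cabs M′)) (sym (ˣ-ksubM M N))) (Bv {N = N ˣ})
  ˣ-⟶ (ξkV V⟶V′)                      = ξ↑ (ˣˣ-⟶ V⟶V′)
  ˣ-⟶ (ξKV₁ (ξλx M⟶M′))               = ξCv₂ (ξabs (ˣ-⟶ M⟶M′))
  ˣ-⟶ (ξKV₂ {K = λx M} V⟶V′)          = ξCv₁ (ˣˣ-⟶ V⟶V′)
  ˣ-⟶ (ξVWK₁ {K = λx M} V⟶V′)         = ξCv₁ (ˣˣ-⟶ V⟶V′)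
  ˣ-⟶ (ξVWK₂ {K = λx M} W⟶W′)         = ξCv₂ (ξpair₁ (ˣˣ-⟶ W⟶W′))
  ˣ-⟶ (ξVWK₃ (ξλx M⟶M′))              = ξCv₂ (ξpair₂ (ˣ-⟶ M⟶M′))

  ˣˣ-⟶ : ∀ {n} {V₁ V₂ : CVal n} → V₁ ⟶CV V₂ → (V₁ ˣˣ) ⟶VV (V₂ ˣˣ)
  ˣˣ-⟶ (ξcλ (ξλk M⟶M′)) = ξlam (ˣ-⟶ M⟶M′)

⁺-⟶ : ∀ {n} {P₁ P₂ : CTm n} → P₁ ⟶P P₂ → (P₁ ⁺) ⟶V (P₂ ⁺)
⁺-⟶ (ξλk M⟶M′) = ˣ-⟶ M⟶M′

theorem3 :
    ((∀ {n} (M : VTm n) → (M ⁻) ⁺ ≡ M)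
      × (∀ {n} (M : VTm n) → (M ≀) ˣ ≡ M)
      × (∀ {n} (V : VVal n) → (V ∼) ˣˣ ≡ V))
  × ((∀ {n} (P : CTm n) → (P ⁺) ⁻ ≡ P)
      × (∀ {n} (M : Cmd n) → (M ˣ) ≀ ≡ M)
      × (∀ {n} (V : CVal n) → (V ˣˣ) ∼ ≡ V))
  × (∀ {n} {M₁ M₂ : VTm n} → M₁ ⟶V M₂ →
        ((M₁ ≀) ⟶M (M₂ ≀)) × ((M₁ ⁻) ⟶P (M₂ ⁻)))
  × ((∀ {n} {M₁ M₂ : Cmd n} → M₁ ⟶M M₂ → (M₁ ˣ) ⟶V (M₂ ˣ))
      × (∀ {n} {P₁ P₂ : CTm n} → P₁ ⟶P P₂ → (P₁ ⁺) ⟶V (P₂ ⁺)))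
theorem3 =
    (⁺-⁻ , ˣ-≀ , ˣˣ-∼)
  , (⁻-⁺ , ≀-ˣ , ∼-ˣˣ)
  , (λ M₁⟶M₂ → ≀-⟶ M₁⟶M₂ , ξλk (≀-⟶ M₁⟶M₂))
  , (ˣ-⟶ , ⁺-⟶)
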